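{- There exists a function $f$ such that for all integers $w,k,t\geq 0$ and every graph $G$ that is a subgraph of a $(w,k,t)$-sum, we have $\chi_{\mathrm{so}}(G)\leq f(w,k,t)$.
   Context: All graphs are finite and simple. For an integer $k\geq 0$, a \emph{$k$-tree} is defined recursively: a clique on $k$ vertices is a $k$-tree, and a graph obtained from a $k$-tree by adding a new vertex adjacent to all vertices of an existing $k$-clique is a $k$-tree. The \emph{strong product} $H\boxtimes H'$ has vertex set $V(H)\times V(H')$, with distinct $(u,x),(v,y)$ adjacent iff ($u=v$ or $uv\in E(H)$) and ($x=y$ or $xy\in E(H')$). The \emph{join} $G+H$ is the disjoint union of $G$ and $H$ plus all edges between them. A \emph{$(k,t)$-summand} is a graph $(H\boxtimes P)+K_t$ with $H$ a $k$-tree and $P$ a path. A \emph{$(w,k,t)$-sum} is defined recursively: every $(k,t)$-summand is one; if $S$ is a $(w,k,t)$-sum with a clique $Q_S$ of size at most $w$ and $F$ is a $(k,t)$-summand with a clique $Q_F$, $|Q_F|=|Q_S|$, then identifying $Q_S$ with $Q_F$ (via a bijection) in the disjoint union of $S$ and $F$ gives a $(w,k,t)$-sum. A proper vertex-coloring $\varphi\colon V(G)\to[t']$ is \emph{strong odd} if for every vertex $v$ and color $i$ the number $|N(v)\cap\varphi^{ -1}(i)|$ is zero or odd; $\chi_{\mathrm{so}}(G)$ is the minimum number of colors of a strong odd coloring of $G$. -}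

module Defs where

open import Data.Bool using (Bool; true; false; _∧_; _∨_; not; if_then_else_)
open import Data.Bool.Properties using (∨-comm)
open import Data.Nat using (ℕ; zero; suc; _+_; _*_; _≤_; _%_; _≡ᵇ_)
open import Data.Fin using (Fin; zero; suc; toℕ; splitAt; remQuot; _≟_)
open import Data.List using (List; length; filterᵇ; allFin)
open import Data.Bool.ListAction using (any)
open import Data.Product using (Σ; _×_; _,_; ∃; ∃-syntax)
open import Data.Sum using (_⊎_; inj₁; inj₂)
open import Function.Definitions using (Injective)
open import Relation.Nullary using (yes; no; ¬_)
open import Relation.Nullary.Decidable using (⌊_⌋)
open import Relation.Binary.PropositionalEquality using (_≡_; _≢_; refl; cong) renaming (sym to ≡-sym)

record Graph : Set where
  field
    n      : ℕ
    adj    : Fin n → Fin n → Bool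
    adj-sym : ∀ u v → adj u v ≡ adj v u
    irrefl : ∀ v → adj v v ≡ false
open Graph public

eqᵇ : ∀ {m} → Fin m → Fin m → Bool
eqᵇ u v = ⌊ u ≟ v ⌋

private
  eqᵇ-sym : ∀ {m} (u v : Fin m) → eqᵇ u v ≡ eqᵇ v u
  eqᵇ-sym u v with u ≟ v | v ≟ u
  ... | yes _  | yes _  = refl
  ... | no _   | no _   = refl
  ... | yes p  | no ¬q  with ¬q (≡-sym p)
  ... | ()
  eqᵇ-sym u v | no ¬p | yes q with ¬p (≡-sym q)
  ... | ()

  eqᵇ-refl : ∀ {m} (u : Fin m) → eqᵇ u u ≡ true
  eqᵇ-refl u with u ≟ u
  ... | yes _ = refl
  ... | no ¬p with ¬p refl
  ... | ()

-- The simple graph generated by a relation r: u ~ v iff u ≠ v and (r u v or r v u).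
-- When r is already symmetric and irreflexive, this is exactly r.
mkGraph : (m : ℕ) → (Fin m → Fin m → Bool) → Graph
mkGraph m r = record
  { n = m
  ; adj = λ u v → not (eqᵇ u v) ∧ (r u v ∨ r v u)
  ; adj-sym = λ u v → sym-lemma u v
  ; irrefl = λ v → irr v
  }
  where
  sym-lemma : ∀ u v → (not (eqᵇ u v) ∧ (r u v ∨ r v u)) ≡ (not (eqᵇ v u) ∧ (r v u ∨ r u v))
  sym-lemma u v rewrite eqᵇ-sym u v | ∨-comm (r u v) (r v u) = refl
  irr : ∀ v → (not (eqᵇ v v) ∧ (r v v ∨ r v v)) ≡ false
  irr v rewrite eqᵇ-refl v = refl

IsClique : (G : Graph) {q : ℕ} → (Fin q → Fin (n G)) → Set
IsClique G Q = Injective _≡_ _≡_ Q × (∀ i j → i ≢ j → adj G (Q i) (Q j) ≡ true)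

complete : ℕ → Graph
complete m = mkGraph m (λ _ _ → true)

path : ℕ → Graph
path m = mkGraph m (λ i j → toℕ j ≡ᵇ suc (toℕ i))

extend : (G : Graph) {k : ℕ} → (Fin k → Fin (n G)) → Graph
extend G {k} C = mkGraph (suc (n G)) r
  where
  r : Fin (suc (n G)) → Fin (suc (n G)) → Bool
  r zero    zero    = false
  r zero    (suc j) = any (λ i → eqᵇ (C i) j) (allFin k)
  r (suc i) zero    = false
  r (suc i) (suc j) = adj G i j

_⊠_ : Graph → Graph → Graph
H ⊠ H' = mkGraph (n H * n H') r
  where
  r : Fin (n H * n H') → Fin (n H * n H') → Bool
  r a b with remQuot {n H} (n H') a | remQuot {n H} (n H') b
  ... | (u , x) | (v , y) = (eqᵇ u v ∨ adj H u v) ∧ (eqᵇ x y ∨ adj H' x y)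

joinK : Graph → ℕ → Graph
joinK G t = mkGraph (n G + t) r
  where
  r : Fin (n G + t) → Fin (n G + t) → Bool
  r a b with splitAt (n G) a | splitAt (n G) b
  ... | inj₁ u | inj₁ v = adj G u v
  ... | _      | _      = true

data KTree (k : ℕ) : Graph → Set where
  base : KTree k (complete k)
  step : ∀ {G} → KTree k G → (C : Fin k → Fin (n G)) → IsClique G C →
         KTree k (extend G C)

data IsSummand (k t : ℕ) : Graph → Set where
  summand : ∀ {H} → KTree k H → (m : ℕ) →
            IsSummand k t (joinK (H ⊠ path (suc m)) t)

-- G is obtained from the disjoint union of S and F by identifying a clique
-- Q_S of S (|Q_S| ≤ w) with a clique Q_F of F via the bijection QS i ↦ QF i.
-- Described up to isomorphism: ιS, ιF embed S and F into G, their images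
-- cover G and meet exactly in the identified clique, and the edges of G are
-- exactly the images of the edges of S and of F.
record CliqueSum (w : ℕ) (S F G : Graph) : Set where
  field
    q      : ℕ
    q≤w    : q ≤ w
    QS     : Fin q → Fin (n S)
    QS-cl  : IsClique S QS
    QF     : Fin q → Fin (n F)
    QF-cl  : IsClique F QF
    ιS     : Fin (n S) → Fin (n G)
    ιS-inj : Injective _≡_ _≡_ ιS
    ιF     : Fin (n F) → Fin (n G)
    ιF-inj : Injective _≡_ _≡_ ιF
    glue   : ∀ i → ιS (QS i) ≡ ιF (QF i)
    meet   : ∀ x y → ιS x ≡ ιF y → ∃[ i ] (x ≡ QS i × y ≡ QF i)
    cover  : ∀ u → (∃[ x ] ιS x ≡ u) ⊎ (∃[ y ] ιF y ≡ u)
    edges→ : ∀ u v → adj G u v ≡ true →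
             (∃[ x ] ∃[ y ] (ιS x ≡ u × ιS y ≡ v × adj S x y ≡ true))
             ⊎ (∃[ x ] ∃[ y ] (ιF x ≡ u × ιF y ≡ v × adj F x y ≡ true))
    edgesS : ∀ x y → adj S x y ≡ true → adj G (ιS x) (ιS y) ≡ true
    edgesF : ∀ x y → adj F x y ≡ true → adj G (ιF x) (ιF y) ≡ true

data IsSum (w k t : ℕ) : Graph → Set where
  single : ∀ {F} → IsSummand k t F → IsSum w k t F
  glue   : ∀ {S F G} → IsSum w k t S → IsSummand k t F → CliqueSum w S F G →
           IsSum w k t G

Subgraph : Graph → Graph → Set
Subgraph G H = Σ (Fin (n G) → Fin (n H)) λ ι →
  Injective _≡_ _≡_ ι × (∀ u v → adj G u v ≡ true → adj H (ι u) (ι v) ≡ true)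

nbrCount : (G : Graph) {c : ℕ} → (Fin (n G) → Fin c) → Fin (n G) → Fin c → ℕ
nbrCount G φ v i = length (filterᵇ (λ u → adj G v u ∧ eqᵇ (φ u) i) (allFin (n G)))

IsStrongOddColoring : (G : Graph) {c : ℕ} → (Fin (n G) → Fin c) → Set
IsStrongOddColoring G φ =
  (∀ u v → adj G u v ≡ true → φ u ≢ φ v) ×
  (∀ v i → nbrCount G φ v i ≡ 0 ⊎ nbrCount G φ v i % 2 ≡ 1)

χso≤ : Graph → ℕ → Set
χso≤ G m = Σ (Fin (n G) → Fin m) (IsStrongOddColoring G)

module Submission where

-- Subgraphs of (w,k,t)-sums have vertex orders in which every vertex weakly r-reaches boundedly
-- many others, so some bounded colouring a separates any two vertices one of which weakly
-- 4-reaches the other. Then a back-neighbour of v shares its colour with no other neighbour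
-- of v, and only forward neighbours matter. Let p 1 u , p 2 u , … be the back-neighbours of
-- u from the latest to the earliest, and p 0 u = u. Since p j u weakly 2-reaches p (j+1) u,
-- among the u with the same sequence a (p 0 u) , a (p 1 u) , … the vertex p j u determines
-- p (j+1) u. So within each class of that initial colouring, the partitions according to
-- p 0 , p 1 , … become coarser and coarser, and parities can be repaired one level at a time,
-- from the finest to the coarsest, each time splitting every colour into three.

open import Defs
open import Algebra.Bundles using (CommutativeRing)
open import Data.Bool as B using (Bool; true; false; not; _∧_; _∨_; _xor_)
open import Data.Bool.ListAction using (any)
open import Data.Bool.Properties using (∧-conicalˡ; ∧-conicalʳ; T-≡; ¬-not; xor-∧-commutativeRing)
open import Data.Empty using (⊥; ⊥-elim)
open import Data.Fin as F using (Fin; zero; suc; toℕ; splitAt; remQuot; combine; fromℕ<; funToFin; finToFun; _↑ˡ_; _↑ʳ_)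
import Data.Fin.Properties as F
open import Data.List using (List; []; _∷_; length; lookup; filter; filterᵇ; allFin; tabulate)
open import Data.List.Membership.Propositional using (_∈_)
open import Data.List.Membership.Propositional.Properties using (∈-filter⁺; ∈-filter⁻; ∈-allFin; ∈-lookup)
open import Data.List.Relation.Binary.Permutation.Propositional using (↭-sym)
open import Data.List.Relation.Binary.Permutation.Propositional.Properties using (∈-resp-↭; ↭-length)
import Data.List.Relation.Unary.All as All
open import Data.List.Relation.Unary.AllPairs using (_∷_)
open import Data.List.Relation.Unary.Any using (here; there; satisfied)
open import Data.List.Relation.Unary.Any.Properties using (any⁻)
open import Data.List.Relation.Unary.Linked using (Linked; [-]; _∷_)
open import Data.List.Relation.Unary.Unique.Propositional using (Unique)
import Data.List.Relation.Unary.Unique.Propositional.Properties as Unique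
import Data.List.Sort as Sort
open import Data.Nat using
  (ℕ; zero; suc; _+_; _*_; _∸_; _^_; _%_; _≡ᵇ_; _≤_; _<_; _≤′_; ≤′-refl; ≤′-step; z≤n; s≤s; _≟_; _<?_)
open import Data.Nat.Properties
open import Data.Product using (Σ; ∃; _×_; _,_; proj₁; proj₂; uncurry) renaming (swap to swap-×)
open import Data.Sum using (_⊎_; inj₁; inj₂; [_,_]; [_,_]′; swap) renaming (map to ⊎-map)
open import Data.Sum.Properties using (swap-involutive)
open import Data.Unit using (⊤; tt)
open import Function using (_∘_; id; case_of_; Equivalence)
open import Function.Definitions using (Injective)
import Relation.Binary.Construct.Flip.EqAndOrd as Flip
import Relation.Binary.Construct.On as On
open import Relation.Binary.PropositionalEquality hiding ([_])
open import Relation.Nullary using (Dec; yes; no; ¬_; does; _×-dec_)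
open import Algebra.Properties.CommutativeSemigroup (CommutativeRing.+-commutativeSemigroup xor-∧-commutativeRing)
  using () renaming (interchange to xor-interchange)

-- Weak reachability.

-- `R r u x` axiomatises "x is weakly r-reachable from u", for the order in which
-- the vertices are ranked.
record Reach (W : Set) (E : W → W → Set) : Set₁ where
  field
    R       : ℕ → W → W → Set
    rank    : W → ℕ
    M       : ℕ
    rank<M  : ∀ u → rank u < M
    R-refl  : ∀ {r u} → R r u u
    R-suc   : ∀ {r u x} → R r u x → R (suc r) u x
    R-edge  : ∀ {u v} → E u v → R 1 u v ⊎ R 1 v u
    R-trans : ∀ {r s u x y} → R r u x → R s x y → R (r + s) u y
    R-share : ∀ {r s u x y} → R r u x → R s u y → R (r + s) x y ⊎ R (r + s) y x
    R-rank  : ∀ {r u x} → R r u x → x ≡ u ⊎ rank x < rank u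

  R-mono : ∀ {r s u x} → r ≤ s → R r u x → R s u x
  R-mono r≤s = go (≤⇒≤′ r≤s)
    where
    go : ∀ {r s u x} → r ≤′ s → R r u x → R s u x
    go ≤′-refl     p = p
    go (≤′-step q) p = R-suc (go q p)

  R-antisym : ∀ {r s u x} → R r u x → R s x u → x ≡ u
  R-antisym p q with R-rank p
  ... | inj₁ x≡u = x≡u
  ... | inj₂ x<u with R-rank q
  ...   | inj₁ u≡x = sym u≡x
  ...   | inj₂ u<x = ⊥-elim (<-asym x<u u<x)

-- Upper bounds on cardinality.

-- A covering instead of a bijection: `e` may repeat itself and leave `P`, so upper bounds combine
-- without deciding `P`.
Enumerates : {W : Set} → (W → Set) → ℕ → Set
Enumerates {W} P m = Σ (Fin m → W) λ e → ∀ {x} → P x → ∃ λ i → e i ≡ x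

enum-weaken : ∀ {W} {P : W → Set} {m m′} → W → m ≤ m′ → Enumerates P m → Enumerates P m′
enum-weaken {m = m} {m′} w m≤m′ (e , c) = e′ , λ p → let i , eq = c p in F.inject≤ i m≤m′ , trans (hit i) eq
  where
  e′ : Fin m′ → _
  e′ i with toℕ i <? m
  ... | yes i<m = e (fromℕ< i<m)
  ... | no  _   = w
  hit : ∀ i → e′ (F.inject≤ i m≤m′) ≡ e i
  hit i with toℕ (F.inject≤ i m≤m′) <? m
  ... | yes i<m = cong e (F.toℕ-injective (trans (F.toℕ-fromℕ< i<m) (F.toℕ-inject≤ i m≤m′)))
  ... | no  i≮m = ⊥-elim (i≮m (subst (_< m) (sym (F.toℕ-inject≤ i m≤m′)) (F.toℕ<n i)))

enum-map : ∀ {V W} {P : V → Set} {Q : W → Set} {m} (g : W → V) →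
           (∀ {x} → P x → ∃ λ y → Q y × g y ≡ x) → Enumerates Q m → Enumerates P m
enum-map g lift (e , c) = g ∘ e , λ p → let y , q , gy≡x = lift p ; i , eq = c q in i , trans (cong g eq) gy≡x

enum-⊎ : ∀ {V W} {P : V ⊎ W → Set} {m m′} → Enumerates (P ∘ inj₁) m → Enumerates (P ∘ inj₂) m′ → Enumerates P (m + m′)
enum-⊎ {P = P} {m} {m′} (e , c) (e′ , c′) = [ inj₁ ∘ e , inj₂ ∘ e′ ] ∘ splitAt m , covers
  where
  covers : ∀ {x} → P x → ∃ λ i → [ inj₁ ∘ e , inj₂ ∘ e′ ] (splitAt m i) ≡ x
  covers {inj₁ x} p with c p
  ... | i , refl = i ↑ˡ m′ , cong [ _ , _ ] (F.splitAt-↑ˡ m i m′)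
  covers {inj₂ x} p with c′ p
  ... | i , refl = m ↑ʳ i , cong [ _ , _ ] (F.splitAt-↑ʳ m m′ i)

enum-Σ : ∀ {I V W} {A : I → Set} {B : I → V → Set} {P : W → Set} {m m′} (f : I → V → W) →
         (∀ {x} → P x → ∃ λ i → ∃ λ y → A i × B i y × f i y ≡ x) →
         Enumerates A m → (∀ i → Enumerates (B i) m′) → Enumerates P (m * m′)
enum-Σ {P = P} {m} {m′} f split (e , c) E = g ∘ remQuot m′ , covers
  where
  g : Fin m × Fin m′ → _
  g (i , j) = f (e i) (proj₁ (E (e i)) j)
  covers : ∀ {x} → P x → ∃ λ i → g (remQuot m′ i) ≡ x
  covers p with split p
  ... | i , y , a , b , refl with c a
  ...   | k , refl with proj₂ (E (e k)) b
  ...     | l , refl = combine k l , cong g (F.remQuot-combine k l)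

enum-⊥ : ∀ {W} {P : W → Set} → (∀ {x} → ¬ P x) → Enumerates P 0
enum-⊥ ¬p = (λ ()) , ⊥-elim ∘ ¬p

-- Bounded reachability and its transfer along embeddings.

Bounded : ∀ {W E} → Reach W E → (ℕ → ℕ) → Set
Bounded ρ b = ∀ r u → Enumerates (Reach.R ρ r u) (b r)

HasReach : (W : Set) → (W → W → Set) → (ℕ → ℕ) → Set₁
HasReach W E b = Σ (Reach W E) λ ρ → Bounded ρ b

Edge : (G : Graph) → Fin (n G) → Fin (n G) → Set
Edge G u v = adj G u v ≡ true

pullback : ∀ {V W D E} (f : V → W) → Injective _≡_ _≡_ f → (∀ {u v} → D u v → E (f u) (f v)) →
           Reach W E → Reach V D
pullback f inj edge ρ = record
  { R = λ r u v → R r (f u) (f v) ; rank = rank ∘ f ; M = M ; rank<M = rank<M ∘ f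
  ; R-refl = R-refl ; R-suc = R-suc ; R-edge = R-edge ∘ edge ; R-trans = R-trans
  ; R-share = R-share ; R-rank = ⊎-map inj id ∘ R-rank }
  where open Reach ρ

-- The order pulls back along `f`, but the enumerations live in `W` and have to be carried back to
-- `V`; hence a left inverse `g` defined on all of `W`.
retract : ∀ {V W D E b} (f : V → W) (g : W → V) → (∀ u → g (f u) ≡ u) →
          (∀ {u v} → D u v → E (f u) (f v)) → HasReach W E b → HasReach V D b
retract f g gf edge (ρ , β) =
  pullback f (λ {u} {v} eq → trans (sym (gf u)) (trans (cong g eq) (gf v))) edge ρ ,
  λ r u → enum-map g (λ {x} p → f x , p , gf x) (β r (f u))

weaken : ∀ {W E b b′} → (∀ r → b r ≤ b′ r) → HasReach W E b → HasReach W E b′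
weaken b≤b′ (ρ , β) = ρ , λ r u → enum-weaken u (b≤b′ r) (β r u)

-- Every earlier vertex counts as reachable, whatever the edges are; this costs only the number of
-- vertices.
complete-reach : ∀ k {E} → HasReach (Fin k) E (λ _ → k)
complete-reach k = ρ , λ r u → id , λ {x} _ → x , refl
  where
  ρ : Reach (Fin k) _
  ρ = record
    { R = λ _ u x → x F.≤ u ; rank = toℕ ; M = k ; rank<M = F.toℕ<n
    ; R-refl = ≤-refl ; R-suc = id ; R-edge = λ {u} {v} _ → F.≤-total v u
    ; R-trans = λ p q → ≤-trans q p ; R-share = λ {r} {s} {u} {x} {y} _ _ → F.≤-total y x
    ; R-rank = λ {r} {u} {x} p → swap (⊎-map id F.toℕ-injective (m≤n⇒m<n∨m≡n p)) }

-- Attaching a graph along a clique.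

-- V comes first in the order; a vertex of W sees V only through the clique Q. When W
-- contains its own copy of Q, as in a clique sum, that copy is harmless surplus.
module Attach {V W D E bV bW} (hV : HasReach V D bV) (hW : HasReach W E bW)
              {q : ℕ} (Q : Fin q → V) (Q-clique : ∀ i j → i ≢ j → D (Q i) (Q j)) where
  private
    module S = Reach (proj₁ hV)
    module F′ = Reach (proj₁ hW)

  -- Every vertex of `W` is joined to the whole clique. This supergraph makes `Via` below
  -- independent of the starting vertex in `W`.
  AttachEdge : V ⊎ W → V ⊎ W → Set
  AttachEdge (inj₁ x) (inj₁ y) = D x y
  AttachEdge (inj₁ x) (inj₂ y) = ∃ λ i → Q i ≡ x
  AttachEdge (inj₂ x) (inj₁ y) = ∃ λ i → Q i ≡ y
  AttachEdge (inj₂ x) (inj₂ y) = E x y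

  attachBound : ℕ → ℕ
  attachBound zero    = 0
  attachBound (suc r) = q * bV r

  -- Entering the clique costs one step, hence the shift in `r`. After that the walk may stay in
  -- `V`: a detour through `W` between two clique vertices is replaced by their edge.
  Via : ℕ → V → Set
  Via zero    x = ⊥
  Via (suc r) x = ∃ λ i → S.R r (Q i) x

  R : ℕ → V ⊎ W → V ⊎ W → Set
  R r (inj₁ u) (inj₁ x) = S.R r u x
  R r (inj₁ u) (inj₂ x) = ⊥
  R r (inj₂ u) (inj₁ x) = Via r x
  R r (inj₂ u) (inj₂ x) = F′.R r u x

  rank : V ⊎ W → ℕ
  rank (inj₁ x) = S.rank x
  rank (inj₂ x) = S.M + F′.rank x

  Via-mono : ∀ {r s x} → r ≤ s → Via r x → Via s x
  Via-mono {suc r} {suc s} (s≤s r≤s) (i , p) = i , S.R-mono r≤s p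

  Via-trans : ∀ {r s x y} → Via r x → S.R s x y → Via (r + s) y
  Via-trans {suc r} (i , p) p′ = i , S.R-trans p p′

  -- The clique edge between the two entry points makes both vertices reachable from the
  -- later entry point.
  Via-share : ∀ {r s x y} → Via r x → Via s y → S.R (r + s) x y ⊎ S.R (r + s) y x
  Via-share {suc r} {suc s} {x} {y} (i , p) (j , p′) with i F.≟ j
  ... | yes refl = ⊎-map up up (S.R-share p p′)
    where
    up : ∀ {x y} → S.R (r + s) x y → S.R (suc r + suc s) x y
    up = S.R-mono (+-mono-≤ (n≤1+n r) (n≤1+n s))
  ... | no i≢j with S.R-edge (Q-clique i j i≢j)
  ...   | inj₁ ij = ⊎-map up up (S.R-share p (S.R-trans ij p′))
    where
    up : ∀ {x y} → S.R (r + suc s) x y → S.R (suc r + suc s) x y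
    up = S.R-suc
  ...   | inj₂ ji = ⊎-map up up (S.R-share (S.R-trans ji p) p′)
    where
    up : ∀ {x y} → S.R (suc r + s) x y → S.R (suc r + suc s) x y
    up = S.R-mono (+-monoʳ-≤ (suc r) (n≤1+n s))

  reach : Reach (V ⊎ W) AttachEdge
  reach = record
    { R = R ; rank = rank ; M = S.M + F′.M ; rank<M = rank<M
    ; R-refl = λ {r} {u} → R-refl r u ; R-suc = λ {r} {u} {x} → R-suc r u x
    ; R-edge = λ {u} {v} → R-edge u v ; R-trans = λ {r} {s} {u} {x} {y} → R-trans r s u x y
    ; R-share = λ {r} {s} {u} {x} {y} → R-share r s u x y ; R-rank = λ {r} {u} {x} → R-rank r u x }
    where
    rank<M : ∀ u → rank u < S.M + F′.M
    rank<M (inj₁ x) = ≤-trans (S.rank<M x) (m≤m+n _ _)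
    rank<M (inj₂ x) = +-monoʳ-< S.M (F′.rank<M x)

    R-refl : ∀ r u → R r u u
    R-refl r (inj₁ x) = S.R-refl
    R-refl r (inj₂ x) = F′.R-refl

    R-suc : ∀ r u x → R r u x → R (suc r) u x
    R-suc r (inj₁ u) (inj₁ x) p = S.R-suc p
    R-suc r (inj₂ u) (inj₁ x) p = Via-mono (n≤1+n r) p
    R-suc r (inj₂ u) (inj₂ x) p = F′.R-suc p

    R-edge : ∀ u v → AttachEdge u v → R 1 u v ⊎ R 1 v u
    R-edge (inj₁ x) (inj₁ y) e          = S.R-edge e
    R-edge (inj₁ x) (inj₂ y) (i , refl) = inj₂ (i , S.R-refl)
    R-edge (inj₂ x) (inj₁ y) (i , refl) = inj₁ (i , S.R-refl)
    R-edge (inj₂ x) (inj₂ y) e          = F′.R-edge e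

    R-trans : ∀ r s u x y → R r u x → R s x y → R (r + s) u y
    R-trans r s (inj₁ u) (inj₁ x) (inj₁ y) p p′ = S.R-trans p p′
    R-trans r s (inj₂ u) (inj₁ x) (inj₁ y) p p′ = Via-trans p p′
    R-trans r s (inj₂ u) (inj₂ x) (inj₁ y) p p′ = Via-mono (m≤n+m s r) p′
    R-trans r s (inj₂ u) (inj₂ x) (inj₂ y) p p′ = F′.R-trans p p′

    R-share : ∀ r s u x y → R r u x → R s u y → R (r + s) x y ⊎ R (r + s) y x
    R-share r s (inj₁ u) (inj₁ x) (inj₁ y) p p′ = S.R-share p p′
    R-share r s (inj₂ u) (inj₁ x) (inj₁ y) p p′ = Via-share p p′
    R-share r s (inj₂ u) (inj₁ x) (inj₂ y) p p′ = inj₂ (Via-mono (m≤m+n r s) p)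
    R-share r s (inj₂ u) (inj₂ x) (inj₁ y) p p′ = inj₁ (Via-mono (m≤n+m s r) p′)
    R-share r s (inj₂ u) (inj₂ x) (inj₂ y) p p′ = F′.R-share p p′

    R-rank : ∀ r u x → R r u x → x ≡ u ⊎ rank x < rank u
    R-rank r (inj₁ u) (inj₁ x) p = ⊎-map (cong inj₁) id (S.R-rank p)
    R-rank r (inj₂ u) (inj₁ x) p = inj₂ (≤-trans (S.rank<M x) (m≤m+n _ _))
    R-rank r (inj₂ u) (inj₂ x) p = ⊎-map (cong inj₂) (+-monoʳ-< S.M) (F′.R-rank p)

  bounded : ∀ {b} → (∀ r → bV r ≤ b r) → (∀ r → attachBound r + bW r ≤ b r) → Bounded reach b
  bounded bV≤b bW≤b r (inj₁ u) =
    enum-weaken (inj₁ u) (bV≤b r)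
      (enum-map inj₁ (λ { {inj₁ x} p → x , p , refl ; {inj₂ x} () }) (proj₂ hV r u))
  bounded bV≤b bW≤b r (inj₂ u) = enum-weaken (inj₂ u) (bW≤b r) (enum-⊎ (via r) (proj₂ hW r u))
    where
    via : ∀ r → Enumerates (Via r) (attachBound r)
    via zero    = enum-⊥ id
    via (suc r) = enum-Σ {A = λ _ → ⊤} (λ _ x → x) (λ {x} (i , p) → i , x , tt , p , refl)
                    (id , λ {i} _ → i , refl) (λ i → proj₂ hV r (Q i))

  hasReach : ∀ {b} → (∀ r → bV r ≤ b r) → (∀ r → attachBound r + bW r ≤ b r) →
             HasReach (V ⊎ W) AttachEdge b
  hasReach p p′ = reach , bounded p p′

-- Strong products with a path.

-- The strong product with a path, ordered lexicographically.
module Strip {V D b} (h : HasReach V D b) (m : ℕ) where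
  private
    module S = Reach (proj₁ h)

  StripEdge : V × Fin (suc m) → V × Fin (suc m) → Set
  StripEdge (u , i) (v , j) = (u ≡ v ⊎ D u v) × toℕ i ≤ 1 + toℕ j × toℕ j ≤ 1 + toℕ i

  -- The path coordinates differ by at most `r`. The last condition orders the copies of a single
  -- vertex of `V`; for `x ≢ u` the rank in `V` already decides.
  R : ℕ → V × Fin (suc m) → V × Fin (suc m) → Set
  R r (u , i) (x , j) = S.R r u x × toℕ i ≤ r + toℕ j × toℕ j ≤ r + toℕ i × (x ≡ u → toℕ j ≤ toℕ i)

  near-trans : ∀ r s {i j l} → i ≤ r + j → j ≤ s + l → i ≤ (r + s) + l
  near-trans r s {l = l} p q = ≤-trans p (≤-trans (+-monoʳ-≤ r q) (≤-reflexive (sym (+-assoc r s l))))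

  rank : V × Fin (suc m) → ℕ
  rank (u , i) = S.rank u * suc m + toℕ i

  rank< : ∀ {a b} (i : Fin (suc m)) → a < b → a * suc m + toℕ i < b * suc m
  rank< {a} {b} i a<b = ≤-trans (+-monoʳ-< (a * suc m) (F.toℕ<n i))
    (≤-trans (≤-reflexive (+-comm (a * suc m) (suc m))) (*-monoˡ-≤ (suc m) a<b))

  reach : Reach (V × Fin (suc m)) StripEdge
  reach = record
    { R = R ; rank = rank ; M = S.M * suc m ; rank<M = λ (u , i) → rank< i (S.rank<M u)
    ; R-refl = λ {r} → S.R-refl , m≤n+m _ r , m≤n+m _ r , λ _ → ≤-refl
    ; R-suc = λ (p , a , c , o) → S.R-suc p , m≤n⇒m≤1+n a , m≤n⇒m≤1+n c , o
    ; R-edge = λ {u} {v} → R-edge u v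
    ; R-trans = λ {r} {s} {(_ , i)} {_} {(_ , l)} (p , a , c , o) (p′ , a′ , c′ , o′) →
        S.R-trans p p′ , near-trans r s a a′ ,
        subst (λ t → toℕ l ≤ t + toℕ i) (+-comm s r) (near-trans s r c′ c) ,
        -- If the walk returns to its first vertex of `V`, antisymmetry makes the intermediate
        -- vertex equal to it, so both order conditions apply and compose.
        λ { refl → let x≡u = S.R-antisym p p′ in ≤-trans (o′ (sym x≡u)) (o x≡u) }
    ; R-share = λ {r} {s} {u} {x} {y} → R-share r s u x y
    ; R-rank = λ {r} {u} {x} → R-rank r u x }
    where
    orient : ∀ r {x y i j} → S.R r x y → toℕ i ≤ r + toℕ j → toℕ j ≤ r + toℕ i →
             R r (x , i) (y , j) ⊎ R r (y , j) (x , i)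
    orient r {i = i} {j} p a c with S.R-rank p
    ... | inj₂ y<x = inj₁ (p , a , c , λ { refl → ⊥-elim (<-irrefl refl y<x) })
    ... | inj₁ refl with ≤-total (toℕ j) (toℕ i)
    ...   | inj₁ j≤i = inj₁ (p , a , c , λ _ → j≤i)
    ...   | inj₂ i≤j = inj₂ (p , c , a , λ _ → i≤j)

    R-edge : ∀ u v → StripEdge u v → R 1 u v ⊎ R 1 v u
    R-edge (u , i) (v , j) (inj₁ refl , a , c) = orient 1 S.R-refl a c
    R-edge (u , i) (v , j) (inj₂ e , a , c) with S.R-edge e
    ... | inj₁ p = orient 1 p a c
    ... | inj₂ p = swap (orient 1 p c a)

    R-share : ∀ r s u x y → R r u x → R s u y → R (r + s) x y ⊎ R (r + s) y x
    R-share r s (u , i) (x , j) (y , l) (p , a , c , _) (p′ , a′ , c′ , _) = decide (S.R-share p p′)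
      where
      jl : toℕ j ≤ (r + s) + toℕ l
      jl = near-trans r s c a′
      lj : toℕ l ≤ (r + s) + toℕ j
      lj = subst (λ t → toℕ l ≤ t + toℕ j) (+-comm s r) (near-trans s r c′ a)
      decide : S.R (r + s) x y ⊎ S.R (r + s) y x → R (r + s) (x , j) (y , l) ⊎ R (r + s) (y , l) (x , j)
      decide (inj₁ p) = orient (r + s) p jl lj
      decide (inj₂ p) = swap (orient (r + s) p lj jl)

    R-rank : ∀ r u x → R r u x → x ≡ u ⊎ rank x < rank u
    R-rank r (u , i) (x , j) (p , _ , _ , o) with S.R-rank p
    ... | inj₂ x<u = inj₂ (≤-trans (rank< j x<u) (m≤m+n _ _))
    ... | inj₁ refl with m≤n⇒m<n∨m≡n (o refl)
    ...   | inj₁ j<i = inj₂ (+-monoʳ-< (S.rank u * suc m) j<i)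
    ...   | inj₂ j≡i = inj₁ (cong (u ,_) (F.toℕ-injective j≡i))

  clamp : ℕ → Fin (suc m)
  clamp t with t <? suc m
  ... | yes t≤m = fromℕ< t≤m
  ... | no  _   = zero

  clamp-toℕ : ∀ j → clamp (toℕ j) ≡ j
  clamp-toℕ j with toℕ j <? suc m
  ... | yes j≤m = F.fromℕ<-toℕ j j≤m
  ... | no  j≰m = ⊥-elim (j≰m (F.toℕ<n j))

  -- The candidates are the `2r + 1` positions from `i - r` to `i + r`, and `j` has index
  -- `(r + j) ∸ i`. Truncated subtraction and `clamp` turn positions off the path into surplus
  -- entries.
  window : ∀ r (i : Fin (suc m)) → Enumerates (λ j → toℕ i ≤ r + toℕ j × toℕ j ≤ r + toℕ i) (suc (r + r))
  window r i = (λ l → clamp ((toℕ i + toℕ l) ∸ r)) , λ {j} (a , c) →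
    fromℕ< (s≤s (bound a c)) , trans (cong clamp (hit a c)) (clamp-toℕ j)
    where
    bound : ∀ {j} → toℕ i ≤ r + toℕ j → toℕ j ≤ r + toℕ i → (r + toℕ j) ∸ toℕ i ≤ r + r
    bound {j} a c = ≤-trans (∸-monoˡ-≤ (toℕ i) (+-monoʳ-≤ r c))
      (≤-reflexive (trans (cong (_∸ toℕ i) (sym (+-assoc r r (toℕ i)))) (m+n∸n≡m (r + r) (toℕ i))))
    hit : ∀ {j} (a : toℕ i ≤ r + toℕ j) (c : toℕ j ≤ r + toℕ i) →
          (toℕ i + toℕ (fromℕ< (s≤s (bound a c)))) ∸ r ≡ toℕ j
    hit {j} a c = trans (cong (λ t → (toℕ i + t) ∸ r) (F.toℕ-fromℕ< (s≤s (bound a c))))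
      (trans (cong (_∸ r) (m+[n∸m]≡n a)) (m+n∸m≡n r (toℕ j)))

  hasReach : HasReach (V × Fin (suc m)) StripEdge (λ r → b r * suc (r + r))
  hasReach = reach , λ r (u , i) →
    enum-Σ {B = λ _ j → toℕ i ≤ r + toℕ j × toℕ j ≤ r + toℕ i} _,_
      (λ {x} (p , a , c , _) → proj₁ x , proj₂ x , p , (a , c) , refl)
      (proj₂ h r u) (λ _ → window r i)

-- Reachability in k-trees.

∨-true : ∀ a {b} → a ∨ b ≡ true → a ≡ true ⊎ b ≡ true
∨-true true  _ = inj₁ refl
∨-true false e = inj₂ e

mkGraph-edge : ∀ c {a b} → c ∧ (a ∨ b) ≡ true → a ≡ true ⊎ b ≡ true
mkGraph-edge true {a} e = ∨-true a e

-- A new vertex reaches itself and whatever its `k` clique neighbours reach with one step less. The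
-- term `suc k` also covers the base clique. The number of steps does not enter, because old
-- vertices reach no newer ones.
ktreeBound : ℕ → ℕ → ℕ
ktreeBound k zero    = suc k
ktreeBound k (suc r) = suc k + k * ktreeBound k r

k<ktreeBound : ∀ k r → k < ktreeBound k r
k<ktreeBound k zero    = ≤-refl
k<ktreeBound k (suc r) = m≤m+n _ _

eqᵇ⇒≡ : ∀ {m} {u v : Fin m} → eqᵇ u v ≡ true → u ≡ v
eqᵇ⇒≡ {u = u} {v} e with u F.≟ v
... | yes u≡v = u≡v

≡⇒eqᵇ : ∀ {m} {u v : Fin m} → u ≡ v → eqᵇ u v ≡ true
≡⇒eqᵇ {u = u} refl with u F.≟ u
... | yes _  = refl
... | no u≢u = ⊥-elim (u≢u refl)

ktree-reach : ∀ {k H} → KTree k H → HasReach (Fin (n H)) (Edge H) (ktreeBound k)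
ktree-reach {k} base = weaken (<⇒≤ ∘ k<ktreeBound k) (complete-reach k)
ktree-reach {k} (step {G} H C C-clique) =
  retract f g (λ { zero → refl ; (suc u) → refl }) (λ {u} {v} → edge u v) (A.hasReach (λ _ → ≤-refl) bound)
  where
  module A = Attach (ktree-reach H) (complete-reach 1 {λ _ _ → ⊤}) C (proj₂ C-clique)
  f : Fin (suc (n G)) → Fin (n G) ⊎ Fin 1
  f zero    = inj₂ zero
  f (suc u) = inj₁ u
  g : Fin (n G) ⊎ Fin 1 → Fin (suc (n G))
  g (inj₁ u) = suc u
  g (inj₂ _) = zero
  bound : ∀ r → A.attachBound r + 1 ≤ ktreeBound k r
  bound zero    = s≤s z≤n
  bound (suc r) = ≤-trans (≤-reflexive (+-comm _ 1)) (s≤s (m≤n+m _ k))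
  clique-nbr : ∀ {j} → any (λ i → eqᵇ (C i) j) (allFin k) ≡ true → ∃ λ i → C i ≡ j
  clique-nbr e = let i , t = satisfied (any⁻ _ (allFin k) (Equivalence.from T-≡ e))
                 in i , eqᵇ⇒≡ (Equivalence.to T-≡ t)
  edge : ∀ u v → adj (extend G C) u v ≡ true → A.AttachEdge (f u) (f v)
  edge zero (suc j) e with ∨-true _ e
  ... | inj₁ e′ = clique-nbr e′
  ... | inj₂ ()
  edge (suc i) zero e = clique-nbr e
  edge (suc i) (suc j) e = [ id , trans (adj-sym G i j) ]′ (mkGraph-edge _ e)

-- Reachability in summands.

-- The apex clique comes first in the order: `t` bounds the reach inside it, `t * t` the reach of a
-- product vertex into it, and the last term is the bound for the strip.
summandBound : ℕ → ℕ → ℕ → ℕ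
summandBound k t r = t + (t * t + ktreeBound k r * suc (r + r))

path-near : ∀ {m} (i j : Fin m) → adj (path m) i j ≡ true → toℕ i ≤ 1 + toℕ j × toℕ j ≤ 1 + toℕ i
path-near i j e = [ one , swap-× ∘ one ]′ (mkGraph-edge _ e)
  where
  one : ∀ {a b} → (b ≡ᵇ suc a) ≡ true → a ≤ 1 + b × b ≤ 1 + a
  one e = let eq = ≡ᵇ⇒≡ _ _ (Equivalence.from T-≡ e) in
    ≤-trans (n≤1+n _) (≤-trans (≤-reflexive (sym eq)) (n≤1+n _)) , ≤-reflexive eq

⊎-adj : ∀ (G : Graph) {u v} → eqᵇ u v ∨ adj G u v ≡ true → u ≡ v ⊎ adj G u v ≡ true
⊎-adj G {u} {v} e with u F.≟ v
... | yes u≡v = inj₁ u≡v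
... | no  _   = inj₂ e

summand-reach : ∀ {k t F} → IsSummand k t F → HasReach (Fin (n F)) (Edge F) (summandBound k t)
summand-reach {k} {t} (summand {H} H-tree m) =
  retract (swap ∘ splitAt (n H * suc m)) (F.join _ t ∘ swap) join-split (λ {u} {v} → join-edge u v)
    (A.hasReach (λ r → m≤m+n t _) bound)
  where
  module P = Strip (ktree-reach H-tree) m
  P-edge : ∀ u v → adj (H ⊠ path (suc m)) u v ≡ true → P.StripEdge (remQuot (suc m) u) (remQuot (suc m) v)
  P-edge a b e = [ strong (remQuot (suc m) a) (remQuot (suc m) b)
                 , flip ∘ strong (remQuot (suc m) b) (remQuot (suc m) a) ]′ (mkGraph-edge _ e)
    where
    flip : ∀ {p q} → P.StripEdge p q → P.StripEdge q p
    flip (inj₁ u≡v , a , c) = inj₁ (sym u≡v) , c , a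
    flip {u , _} {v , _} (inj₂ e , a , c) = inj₂ (trans (adj-sym H v u) e) , c , a
    near : ∀ {x y} → x ≡ y ⊎ adj (path (suc m)) x y ≡ true → toℕ x ≤ 1 + toℕ y × toℕ y ≤ 1 + toℕ x
    near (inj₁ refl) = n≤1+n _ , n≤1+n _
    near (inj₂ e)    = path-near _ _ e
    strong : ∀ p q → (eqᵇ (proj₁ p) (proj₁ q) ∨ adj H (proj₁ p) (proj₁ q)) ∧
                     (eqᵇ (proj₂ p) (proj₂ q) ∨ adj (path (suc m)) (proj₂ p) (proj₂ q)) ≡ true →
             P.StripEdge p q
    strong p q e = ⊎-adj H (∧-conicalˡ _ _ e) , near (⊎-adj (path (suc m)) (∧-conicalʳ _ _ e))
  P-reach : HasReach (Fin (n H * suc m)) (Edge (H ⊠ path (suc m))) (λ r → ktreeBound k r * suc (r + r))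
  P-reach = retract (remQuot (suc m)) (uncurry combine) (F.combine-remQuot {n H} (suc m))
              (λ {u} {v} → P-edge u v) P.hasReach
  -- All of the apex clique serves as `Q`, so that every product vertex is joined to every apex
  -- vertex.
  module A = Attach (complete-reach t {λ _ _ → ⊤}) P-reach id (λ _ _ _ → tt)
  bound : ∀ r → A.attachBound r + ktreeBound k r * suc (r + r) ≤ summandBound k t r
  bound zero    = ≤-trans (m≤n+m _ (t * t)) (m≤n+m _ t)
  bound (suc r) = m≤n+m _ t
  f : Fin (n H * suc m + t) → Fin t ⊎ Fin (n H * suc m)
  f = swap ∘ splitAt (n H * suc m)
  join-split : ∀ u → F.join (n H * suc m) t (swap (f u)) ≡ u
  join-split u = trans (cong (F.join _ t) (swap-involutive (splitAt (n H * suc m) u))) (F.join-splitAt _ t u)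
  join-edge : ∀ u v → adj (joinK (H ⊠ path (suc m)) t) u v ≡ true → A.AttachEdge (f u) (f v)
  join-edge u v e with splitAt (n H * suc m) u | splitAt (n H * suc m) v | e
  ... | inj₁ x | inj₁ y | e′ = [ id , trans (adj-sym (H ⊠ path (suc m)) x y) ]′ (mkGraph-edge _ e′)
  ... | inj₁ x | inj₂ y | _  = y , refl
  ... | inj₂ x | inj₁ y | _  = x , refl
  ... | inj₂ x | inj₂ y | _  = tt

-- Reachability in clique sums.

-- Each newly glued summand is placed last and sees the earlier part through at most `w` vertices.
-- Earlier vertices keep their bound, so the number of summands does not enter.
sumBound : ℕ → ℕ → ℕ → ℕ → ℕ
sumBound w k t zero    = summandBound k t zero
sumBound w k t (suc r) = w * sumBound w k t r + summandBound k t (suc r)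

sum-reach : ∀ {w k t S} → IsSum w k t S → HasReach (Fin (n S)) (Edge S) (sumBound w k t)
sum-reach {w} {k} {t} (single F-summand) = weaken bound (summand-reach F-summand)
  where
  bound : ∀ r → summandBound k t r ≤ sumBound w k t r
  bound zero    = ≤-refl
  bound (suc r) = m≤n+m _ (w * sumBound w k t r)
sum-reach {w} {k} {t} (glue {S} {F} {G} S-sum F-summand cs) =
  retract (proj₁ ∘ f) g (proj₂ ∘ f) (λ {u} {v} → edge u v) (A.hasReach (λ _ → ≤-refl) bound)
  where
  open CliqueSum cs
  module A = Attach (sum-reach S-sum) (summand-reach F-summand) QS (proj₂ QS-cl)
  bound : ∀ r → A.attachBound r + summandBound k t r ≤ sumBound w k t r
  bound zero    = ≤-refl
  bound (suc r) = +-monoˡ-≤ _ (*-monoˡ-≤ (sumBound w k t r) q≤w)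
  g : Fin (n S) ⊎ Fin (n F) → Fin (n G)
  g = [ ιS , ιF ]
  inS? : ∀ u → Dec (∃ λ x → ιS x ≡ u)
  inS? u = F.any? (λ x → ιS x F.≟ u)
  -- An identified vertex is sent to its copy in `S`; its copy in `F` stays outside the image.
  f : ∀ u → Σ (Fin (n S) ⊎ Fin (n F)) λ p → g p ≡ u
  f u with inS? u | cover u
  ... | yes (x , eq) | _             = inj₁ x , eq
  ... | no _         | inj₂ (y , eq) = inj₂ y , eq
  ... | no ¬S        | inj₁ xS       = ⊥-elim (¬S xS)
  f-S : ∀ x → proj₁ (f (ιS x)) ≡ inj₁ x
  f-S x with inS? (ιS x) | cover (ιS x)
  ... | yes (x′ , eq) | _      = cong inj₁ (ιS-inj eq)
  ... | no ¬S         | inj₁ xS = ⊥-elim (¬S xS)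
  ... | no ¬S         | inj₂ _  = ⊥-elim (¬S (x , refl))
  f-F : ∀ y → (∃ λ i → proj₁ (f (ιF y)) ≡ inj₁ (QS i) × y ≡ QF i) ⊎ proj₁ (f (ιF y)) ≡ inj₂ y
  f-F y with inS? (ιF y) | cover (ιF y)
  ... | yes (x , eq) | _              = let i , x≡ , y≡ = meet x y eq in inj₁ (i , cong inj₁ x≡ , y≡)
  ... | no _         | inj₂ (y′ , eq) = inj₂ (cong inj₂ (ιF-inj eq))
  ... | no ¬S        | inj₁ xS        = ⊥-elim (¬S xS)
  edge : ∀ u v → adj G u v ≡ true → A.AttachEdge (proj₁ (f u)) (proj₁ (f v))
  edge u v e with edges→ u v e
  ... | inj₁ (x , y , refl , refl , xy) = subst₂ A.AttachEdge (sym (f-S x)) (sym (f-S y)) xy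
  ... | inj₂ (x , y , refl , refl , xy) with f-F x | f-F y
  ...   | inj₂ p              | inj₂ p′               = subst₂ A.AttachEdge (sym p) (sym p′) xy
  ...   | inj₁ (i , p , _)    | inj₂ p′               = subst₂ A.AttachEdge (sym p) (sym p′) (i , refl)
  ...   | inj₂ p              | inj₁ (j , p′ , _)     = subst₂ A.AttachEdge (sym p) (sym p′) (j , refl)
  -- An edge of `F` between two identified vertices is also an edge of `S`, as `QS` is a clique;
  -- irreflexivity of `F` gives `i ≢ j`.
  ...   | inj₁ (i , p , refl) | inj₁ (j , p′ , refl)  =
    subst₂ A.AttachEdge (sym p) (sym p′) (proj₂ QS-cl i j
      λ { refl → case trans (sym xy) (irrefl F x) of λ () })

-- Greedy colouring along the order.

fresh : ∀ {B} (f : Fin B → Fin (suc B)) → ∃ λ c → ∀ i → f i ≢ c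
fresh {B} f with F.¬∀⟶∃¬ (suc B) (λ c → ∃ λ i → f i ≡ c) (λ c → F.any? (λ i → f i F.≟ c)) onto-absurd
  where
  onto-absurd : ¬ (∀ c → ∃ λ i → f i ≡ c)
  onto-absurd g with F.pigeonhole (n<1+n B) (proj₁ ∘ g)
  ... | i , j , i<j , eq =
    F.<⇒≢ i<j (trans (sym (proj₂ (g i))) (trans (cong f eq) (proj₂ (g j))))
... | c , c∉f = c , λ i eq → c∉f (i , eq)

module _ {W E b} (h : HasReach W E b) (r : ℕ) where
  open Reach (proj₁ h)

  private
    ProperBelow : ℕ → (W → Fin (suc (b r))) → Set
    ProperBelow N a = ∀ {u x} → rank u < N → R r u x → rank x < rank u → a u ≢ a x

    -- All vertices of rank `N` are recoloured at once, which is safe because distinct vertices of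
    -- equal rank do not reach each other. Each avoids the at most `b r` colours on its list.
    greedy : ∀ N → Σ (W → Fin (suc (b r))) (ProperBelow N)
    greedy zero    = (λ _ → zero) , λ ()
    greedy (suc N) = a′ , proper
      where
      a = proj₁ (greedy N)
      e : W → Fin (b r) → W
      e u = proj₁ (proj₂ h r u)
      a′ : W → Fin (suc (b r))
      a′ u with rank u ≟ N
      ... | yes _ = proj₁ (fresh (a ∘ e u))
      ... | no  _ = a u
      a′-below : ∀ {x} → rank x < N → a′ x ≡ a x
      a′-below {x} x<N with rank x ≟ N
      ... | yes x≡N = ⊥-elim (<-irrefl x≡N x<N)
      ... | no  _   = refl
      proper : ProperBelow (suc N) a′
      proper {u} {x} (s≤s u≤N) p x<u eq with rank u ≟ N | trans eq (a′-below (<-≤-trans x<u u≤N))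
      ... | no u≢N  | eq′ = proj₂ (greedy N) (≤∧≢⇒< u≤N u≢N) p x<u eq′
      ... | yes _   | eq′ = let i , ei≡x = proj₂ (proj₂ h r u) p in
        proj₂ (fresh (a ∘ e u)) i (trans (cong a ei≡x) (sym eq′))

  reach-colouring : Σ (W → Fin (suc (b r))) λ a → ∀ {u x} → R r u x → a u ≡ a x → u ≡ x
  reach-colouring = proj₁ (greedy M) , λ {u} p eq →
    [ sym , (λ x<u → ⊥-elim (proj₂ (greedy M) (rank<M u) p x<u eq)) ]′ (R-rank p)

-- Parity of finite sets.

parity : ∀ {n} → (Fin n → Bool) → Bool
parity {zero}  b = false
parity {suc n} b = b zero xor parity (b ∘ suc)

parity-cong : ∀ {n} {b b′ : Fin n → Bool} → (∀ u → b u ≡ b′ u) → parity b ≡ parity b′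
parity-cong {zero}  eq = refl
parity-cong {suc n} eq = cong₂ _xor_ (eq zero) (parity-cong (eq ∘ suc))

parity-xor : ∀ {n} (b b′ : Fin n → Bool) → parity (λ u → b u xor b′ u) ≡ parity b xor parity b′
parity-xor {zero}  b b′ = refl
parity-xor {suc n} b b′ = trans
  (cong ((b zero xor b′ zero) xor_) (parity-xor (b ∘ suc) (b′ ∘ suc)))
  (xor-interchange (b zero) (b′ zero) (parity (b ∘ suc)) (parity (b′ ∘ suc)))

parity-none : ∀ {n} {b : Fin n → Bool} → (∀ u → b u ≡ false) → parity b ≡ false
parity-none {zero}  none = refl
parity-none {suc n} none = cong₂ _xor_ (none zero) (parity-none (none ∘ suc))

parity-one : ∀ {n} {b : Fin n → Bool} v → b v ≡ true → (∀ u → b u ≡ true → u ≡ v) → parity b ≡ true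
parity-one zero    bv only = cong₂ _xor_ bv (parity-none (λ u → ¬-not λ e → case only (suc u) e of λ ()))
parity-one {b = b} (suc v) bv only with b zero in eq
... | true  = ⊥-elim (F.0≢1+n (only zero eq))
... | false = parity-one v bv (λ u e → F.suc-injective (only (suc u) e))

odd : ℕ → Bool
odd zero    = false
odd (suc n) = not (odd n)

odd-%2 : ∀ n → odd n ≡ true → n % 2 ≡ 1
odd-%2 (suc zero)    _ = refl
odd-%2 (suc (suc n)) e with odd n in eq
... | true = odd-%2 n eq

odd-count : ∀ {n m} (b : Fin m → Bool) (f : Fin n → Fin m) → odd (length (filterᵇ b (tabulate f))) ≡ parity (b ∘ f)
odd-count {zero}  b f = refl
odd-count {suc n} b f with b (f zero)
... | true  = cong not (odd-count b (f ∘ suc))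
... | false = odd-count b (f ∘ suc)

count-none : ∀ {A : Set} (b : A → Bool) (xs : List A) → (∀ x → b x ≡ false) → length (filterᵇ b xs) ≡ 0
count-none b []       none = refl
count-none b (x ∷ xs) none rewrite none x = count-none b xs none

record Decides {n} (P : Fin n → Set) (b : Fin n → Bool) : Set where
  constructor decides
  field
    sound : ∀ {u} → b u ≡ true → P u
    total : ∀ {u} → P u → b u ≡ true

decides-≗ : ∀ {n} {P : Fin n → Set} {b b′} → Decides P b → Decides P b′ → ∀ u → b u ≡ b′ u
decides-≗ {b = b} {b′} d d′ u with b u in eq | b′ u in eq′
... | true  | true  = refl
... | false | false = refl
... | true  | false = trans (sym (Decides.total d′ (Decides.sound d eq))) eq′
... | false | true  = sym (trans (sym (Decides.total d (Decides.sound d′ eq′))) eq)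

-- The size of `P` modulo 2 as a relation that carries its own decision of `P`. This allows `P` to
-- be exchanged for an equivalent predicate; by `decides-≗` the value is determined by `P`.
Parity : ∀ {n} → (Fin n → Set) → Bool → Set
Parity P x = ∃ λ b → Decides P b × parity b ≡ x

Parity-⇔ : ∀ {n} {P Q : Fin n → Set} {x} → (∀ {u} → P u → Q u) → (∀ {u} → Q u → P u) → Parity P x → Parity Q x
Parity-⇔ f g (b , decides s c , e) = b , decides (f ∘ s) (c ∘ g) , e

Parity-dec : ∀ {n} {P : Fin n → Set} → (∀ u → Dec (P u)) → ∃ (Parity P)
Parity-dec {P = P} P? = _ , (λ u → does (P? u)) , decides (λ {u} → sound u) (λ {u} → total u) , refl
  where
  sound : ∀ u → does (P? u) ≡ true → P u
  sound u e with yes p ← P? u = p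
  total : ∀ u → P u → does (P? u) ≡ true
  total u p with P? u
  ... | yes _ = refl
  ... | no ¬p = ⊥-elim (¬p p)

-- The removed set lies inside `P`, so the difference is a symmetric difference, on which parity is
-- additive.
Parity-minus : ∀ {n} {P Q : Fin n → Set} {x y} → Parity P x → Parity (λ u → P u × Q u) y →
               Parity (λ u → P u × ¬ Q u) (x xor y)
Parity-minus {P = P} {Q} (b , decides s c , e) (b′ , decides s′ c′ , e′) =
  (λ u → b u xor b′ u) , decides (λ {u} → sound u) (λ {u} → total u) , trans (parity-xor b b′) (cong₂ _xor_ e e′)
  where
  sound : ∀ u → b u xor b′ u ≡ true → P u × ¬ Q u
  sound u e with b u in eq | b′ u in eq′
  ... | true  | false = s eq , λ q → case trans (sym eq′) (c′ (s eq , q)) of λ ()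
  ... | false | true  = case trans (sym eq) (c (proj₁ (s′ eq′))) of λ ()
  total : ∀ u → P u × ¬ Q u → b u xor b′ u ≡ true
  total u (p , ¬q) with b u in eq | b′ u in eq′
  ... | true  | false = refl
  ... | true  | true  = ⊥-elim (¬q (proj₂ (s′ eq′)))
  ... | false | _     = case trans (sym eq) (c p) of λ ()

Parity-one : ∀ {n} {P : Fin n → Set} v → (∀ {u} → P u → u ≡ v) → P v → (∀ u → Dec (P u)) → Parity P true
Parity-one v only Pv P? = let _ , b , d , _ = Parity-dec P? in
  b , d , parity-one v (Decides.total d Pv) (λ u e → only (Decides.sound d e))

count-odd : ∀ {n} {P : Fin n → Set} {b} → Parity P true → Decides P b → length (filterᵇ b (allFin n)) % 2 ≡ 1
count-odd {n} {b = b} (b′ , d′ , e) d = odd-%2 (length (filterᵇ b (allFin n)))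
  (trans (odd-count b id) (trans (parity-cong (decides-≗ d d′)) e))

-- Repairing parities level by level.

palette : ℕ → ℕ → ℕ
palette m zero    = m
palette m (suc d) = palette m d * 3

module Rounds {n} (p : ℕ → Fin n → Fin n) (p-zero : ∀ u → p 0 u ≡ u) where

  Class : ∀ {m} → ℕ → (Fin n → Fin m) → Fin n → Fin n → Set
  Class j c u₀ u = p j u ≡ p j u₀ × c u ≡ c u₀

  Nested : ∀ {m} → ℕ → (Fin n → Fin m) → Set
  Nested j c = ∀ {u u′} → c u ≡ c u′ → p j u ≡ p j u′ → p (suc j) u ≡ p (suc j) u′

  module Round {m} (d : ℕ) (c : Fin n → Fin m) (nested : Nested d c) (oddBlocks : ∀ u₀ → Parity (Class d c u₀) true) where

    Block : Fin n → Fin m → Fin n → Set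
    Block y z u = p (suc d) u ≡ y × c u ≡ z

    block? : ∀ y z u → Dec (Block y z u)
    block? y z u = (p (suc d) u F.≟ y) ×-dec (c u F.≟ z)

    -- Blocks of odd size keep their colour. In a block of even size the child block (same p d)
    -- of a representative r, which has odd size, is separated from the rest, which then has odd size too.
    mark : ∀ {P : Fin n → Set} → Bool → Dec (∃ P) → Fin n → Fin 3
    mark true  _             x = zero
    mark false (no _)        x = zero
    mark false (yes (r , _)) x with x F.≟ p d r
    ... | yes _ = suc zero
    ... | no  _ = suc (suc zero)

    mark-odd : ∀ {y z x₀} bit (rep : Dec (∃ (Block y z))) → Parity (Block y z) bit → ∃ (Block y z) →
               Parity (λ u → Block y z u × mark bit rep (p d u) ≡ mark bit rep x₀) true
    mark-odd true  rep       par _ = Parity-⇔ (_, refl) proj₁ par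
    mark-odd false (no ¬∃)   _   ∃ = ⊥-elim (¬∃ ∃)
    mark-odd {y} {z} {x₀} false (yes (r , refl , refl)) par _ = byBlock (x₀ F.≟ p d r)
      where
      rep = yes (r , refl , refl)
      -- By nestedness the whole level-`d` class of `r` lies in this block, so the child block is
      -- that class and is odd by assumption.
      child : Parity (λ u → Block y z u × p d u ≡ p d r) true
      child = Parity-⇔ (λ (q , e) → (nested e q , e) , q) (λ ((_ , e) , q) → q , e) (oddBlocks r)
      one : ∀ {x} → x ≡ p d r → mark {Block y z} false rep x ≡ suc zero
      one {x} e with x F.≟ p d r
      ... | yes _ = refl
      ... | no ¬e = ⊥-elim (¬e e)
      two : ∀ {x} → x ≢ p d r → mark {Block y z} false rep x ≡ suc (suc zero)
      two {x} ¬e with x F.≟ p d r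
      ... | yes e = ⊥-elim (¬e e)
      ... | no _  = refl
      one⁻ : ∀ {x} → mark {Block y z} false rep x ≡ suc zero → x ≡ p d r
      one⁻ {x} e with yes eq ← x F.≟ p d r = eq
      two⁻ : ∀ {x} → mark {Block y z} false rep x ≡ suc (suc zero) → x ≢ p d r
      two⁻ {x} e with no ¬eq ← x F.≟ p d r = ¬eq
      byBlock : Dec (x₀ ≡ p d r) → Parity (λ u → Block y z u × mark {Block y z} false rep (p d u) ≡ mark {Block y z} false rep x₀) true
      byBlock (yes e) = Parity-⇔ (λ (B , q) → B , trans (one q) (sym (one e))) (λ (B , q) → B , one⁻ (trans q (one e))) child
      -- Here the block is even and the child odd, so the remainder is odd.
      byBlock (no ¬e) = Parity-⇔ (λ (B , q) → B , trans (two q) (sym (two ¬e))) (λ (B , q) → B , two⁻ (trans q (two ¬e)))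
                          (Parity-minus par child)

    bit : Fin n → Fin m → Bool
    bit y z = proj₁ (Parity-dec (block? y z))

    -- The parity bit and the representative depend on `y` and `z` alone, so all vertices of a block
    -- use the same ones.
    E : Fin n → Fin n → Fin m → Fin 3
    E x y z = mark (bit y z) (F.any? (block? y z)) x

    c′ : Fin n → Fin (m * 3)
    c′ u = combine (c u) (E (p d u) (p (suc d) u) (c u))

    c′-refines : ∀ {u u′} → c′ u ≡ c′ u′ → c u ≡ c u′
    c′-refines = F.combine-injectiveˡ _ _ _ _

    new : ∀ u₀ → Parity (Class (suc d) c′ u₀) true
    new u₀ = Parity-⇔ to from
      (mark-odd {x₀ = p d u₀} _ (F.any? (block? y z)) (proj₂ (Parity-dec (block? y z))) (u₀ , refl , refl))
      where
      y = p (suc d) u₀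
      z = c u₀
      to : ∀ {u} → Block y z u × E (p d u) y z ≡ E (p d u₀) y z → Class (suc d) c′ u₀ u
      to {u} ((ey , ez) , e) = ey , cong₂ combine ez (trans (cong₂ (E (p d u)) ey ez) e)
      from : ∀ {u} → Class (suc d) c′ u₀ u → Block y z u × E (p d u) y z ≡ E (p d u₀) y z
      from {u} (ey , e) = (ey , ez) , trans (sym (cong₂ (E (p d u)) ey ez)) (F.combine-injectiveʳ (c u) _ (c u₀) _ e)
        where ez = c′-refines e

    -- On such a class `p d` is constant, hence by nestedness so is `p (suc d)`. The added digit
    -- depends only on these and on `c`, so the class is not split.
    old : ∀ {j} → (∀ {u u′} → c u ≡ c u′ → p j u ≡ p j u′ → p d u ≡ p d u′) →
          (∀ u₀ → Parity (Class j c u₀) true) → ∀ u₀ → Parity (Class j c′ u₀) true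
    old coarse par u₀ = Parity-⇔ to (λ (q , e) → q , c′-refines e) (par u₀)
      where
      to : ∀ {u} → Class _ c u₀ u → Class _ c′ u₀ u
      to {u} (q , e) = q , cong₂ combine e
        (trans (cong₂ (E (p d u)) (nested e q′) e) (cong (λ x → E x (p (suc d) u₀) (c u₀)) q′))
        where q′ = coarse e q

  -- Level 0 is odd from the start, its classes being singletons. Each round makes one further level
  -- odd by `new` and preserves the finer ones by `old`; nestedness passes to refinements of the
  -- colouring.
  rounds : ∀ d {m} (c : Fin n → Fin m) → (∀ {j} → j < d → Nested j c) →
           Σ (Fin n → Fin (palette m d)) λ c′ →
             (∀ {u u′} → c′ u ≡ c′ u′ → c u ≡ c u′) × (∀ {j} → j ≤ d → ∀ u₀ → Parity (Class j c′ u₀) true)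
  rounds zero c nested = c , id , λ { z≤n u₀ → Parity-one u₀
    (λ {u} (q , _) → trans (sym (p-zero u)) (trans q (p-zero u₀))) (refl , refl)
    (λ u → (p 0 u F.≟ p 0 u₀) ×-dec (c u F.≟ c u₀)) }
  rounds (suc d) c nested with rounds d c (λ j<d → nested (m≤n⇒m≤1+n j<d))
  ... | c₁ , refines , par = c′ , refines ∘ c′-refines , good
    where
    nested₁ : ∀ {j} → j < suc d → Nested j c₁
    nested₁ j<d e = nested j<d (refines e)
    open Round d c₁ (nested₁ ≤-refl) (par ≤-refl)
    coarse : ∀ {j i} → j ≤′ i → i ≤ d → ∀ {u u′} → c₁ u ≡ c₁ u′ → p j u ≡ p j u′ → p i u ≡ p i u′
    coarse ≤′-refl      _   e q = q
    coarse (≤′-step jd) i<d e q = nested₁ (m≤n⇒m≤1+n i<d) e (coarse jd (<⇒≤ i<d) e q)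
    good : ∀ {j} → j ≤ suc d → ∀ u₀ → Parity (Class j c′ u₀) true
    good {j} j≤ with m≤n⇒m<n∨m≡n j≤
    ... | inj₁ (s≤s j≤d) = old (coarse (≤⇒≤′ j≤d) ≤-refl) (par j≤d)
    ... | inj₂ refl      = new

-- Saturating lookup in lists.

-- Saturating lookup in x ∷ xs: past the end, the last element is repeated.
nth : {A : Set} → A → List A → ℕ → A
nth x xs       zero    = x
nth x []       (suc j) = x
nth x (y ∷ ys) (suc j) = nth y ys j

nth-∈ : ∀ {A : Set} (x : A) xs j → nth x xs j ∈ x ∷ xs
nth-∈ x xs       zero    = here refl
nth-∈ x []       (suc j) = here refl
nth-∈ x (y ∷ ys) (suc j) = there (nth-∈ y ys j)

∈-nth : ∀ {A : Set} {x y : A} {xs} → y ∈ xs → ∃ λ j → j ≤ length xs × nth x xs j ≡ y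
∈-nth (here refl) = 1 , s≤s z≤n , refl
∈-nth (there y∈)  = let j , j≤ , eq = ∈-nth y∈ in suc j , s≤s j≤ , eq

nth-chain : ∀ {A : Set} {P : A → A → Set} → (∀ {x} → P x x) → ∀ {x xs} → Linked P (x ∷ xs) →
            ∀ j → P (nth x xs j) (nth x xs (suc j))
nth-chain refl′ {xs = []}     _       zero    = refl′
nth-chain refl′ {xs = []}     _       (suc j) = refl′
nth-chain refl′ {xs = _ ∷ _}  (p ∷ l) zero    = p
nth-chain refl′ {xs = _ ∷ _}  (p ∷ l) (suc j) = nth-chain refl′ l j

Unique-lookup : ∀ {A : Set} {xs : List A} → Unique xs → ∀ {i j} → i F.< j → lookup xs i ≢ lookup xs j
Unique-lookup (x∉ ∷ _)  {zero}  {suc j} _         = All.lookup x∉ (∈-lookup j)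
Unique-lookup (_ ∷ xs!) {suc i} {suc j} (s≤s i<j) = Unique-lookup xs! i<j

-- The strong odd colouring.

module StrongOdd (G : Graph) (ρ : Reach (Fin (n G)) (Edge G)) {c : ℕ} (a : Fin (n G) → Fin c)
                 (a-inj : ∀ {u x} → Reach.R ρ 4 u x → a u ≡ a x → u ≡ x) where
  open Reach ρ

  V : Set
  V = Fin (n G)

  Back : V → V → Set
  Back u x = adj G u x ≡ true × rank x < rank u

  back? : ∀ u x → Dec (Back u x)
  back? u x = (adj G u x B.≟ true) ×-dec (rank x <? rank u)

  back : V → List V
  back u = filter (back? u) (allFin (n G))

  -- The flipped order lists the latest back-neighbour first.
  open Sort (Flip.decTotalOrder (On.decTotalOrder ≤-decTotalOrder rank)) using (sort; sort-↭; sort-↗)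

  backs : V → List V
  backs u = sort (back u)

  backs⁺ : ∀ {u x} → Back u x → x ∈ backs u
  backs⁺ {u} {x} b = ∈-resp-↭ (↭-sym (sort-↭ (back u))) (∈-filter⁺ (back? u) (∈-allFin x) b)

  backs⁻ : ∀ {u x} → x ∈ backs u → Back u x
  backs⁻ {u} x∈ = proj₂ (∈-filter⁻ (back? u) {xs = allFin (n G)} (∈-resp-↭ (sort-↭ (back u)) x∈))

  Back⇒R : ∀ {u x} → Back u x → R 1 u x
  Back⇒R (e , x<u) with R-edge e
  ... | inj₁ p = p
  ... | inj₂ p with R-rank p
  ...   | inj₁ refl = R-refl
  ...   | inj₂ u<x  = ⊥-elim (<-asym x<u u<x)

  adj⇒Back : ∀ {u v} → adj G u v ≡ true → Back u v ⊎ Back v u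
  adj⇒Back {u} {v} e with R-edge e
  ... | inj₁ p with R-rank p
  ...   | inj₁ refl = case trans (sym e) (irrefl G u) of λ ()
  ...   | inj₂ v<u  = inj₁ (e , v<u)
  adj⇒Back {u} {v} e | inj₂ p with R-rank p
  ...   | inj₁ refl = case trans (sym e) (irrefl G u) of λ ()
  ...   | inj₂ u<v  = inj₂ (trans (adj-sym G v u) e , u<v)

  a-inj-share : ∀ {r s v x y} → r + s ≤ 4 → R r v x → R s v y → a x ≡ a y → x ≡ y
  a-inj-share rs≤4 p q e with R-share p q
  ... | inj₁ xy = a-inj (R-mono rs≤4 xy) e
  ... | inj₂ yx = sym (a-inj (R-mono rs≤4 yx) (sym e))

  -- Two back-neighbours of `u` share `u`, so one reaches the other within 2 and `a` separates them;
  -- there are only `c` colours.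
  back-length : ∀ u → length (back u) ≤ c
  back-length u = ≮⇒≥ λ c<len →
    let i , j , i<j , e = F.pigeonhole c<len (a ∘ lookup (back u))
    in Unique-lookup (Unique.filter⁺ (back? u) (Unique.allFin⁺ (n G))) i<j
         (a-inj-share (s≤s (s≤s z≤n)) (reach i) (reach j) e)
    where
    reach : ∀ i → R 1 u (lookup (back u) i)
    reach i = Back⇒R (proj₂ (∈-filter⁻ (back? u) {xs = allFin (n G)} (∈-lookup i)))

  p : ℕ → V → V
  p j u = nth u (backs u) j

  p-∈ : ∀ j u → p j u ≡ u ⊎ Back u (p j u)
  p-∈ j u with nth-∈ u (backs u) j
  ... | here eq  = inj₁ eq
  ... | there x∈ = inj₂ (backs⁻ x∈)

  p-reach : ∀ j u → R 1 u (p j u)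
  p-reach j u with p j u | p-∈ j u
  ... | _ | inj₁ refl = R-refl
  ... | _ | inj₂ b    = Back⇒R b

  p-decreasing : ∀ j u → rank (p (suc j) u) ≤ rank (p j u)
  p-decreasing j u = nth-chain {P = λ x y → rank y ≤ rank x} ≤-refl (start (backs u) backs⁻ (sort-↗ (back u))) j
    where
    start : ∀ xs → (∀ {x} → x ∈ xs → Back u x) → Linked (λ x y → rank y ≤ rank x) xs →
            Linked (λ x y → rank y ≤ rank x) (u ∷ xs)
    start []       _    _ = [-]
    start (x ∷ xs) back l = <⇒≤ (proj₂ (back (here refl))) ∷ l

  -- Both vertices are reached from `u` within 1, so one reaches the other within 2. The sorting
  -- fixes the direction, and past the end of the list they coincide.
  p-step : ∀ j u → R 2 (p j u) (p (suc j) u)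
  p-step j u with R-share (p-reach j u) (p-reach (suc j) u)
  ... | inj₁ q = q
  ... | inj₂ q with R-rank q
  ...   | inj₁ eq = subst (λ x → R 2 x (p (suc j) u)) (sym eq) R-refl
  ...   | inj₂ lt = ⊥-elim (<⇒≱ lt (p-decreasing j u))

  p-hits : ∀ {u x} → Back u x → ∃ λ j → j ≤ c × p j u ≡ x
  p-hits {u} b = let j , j≤ , eq = ∈-nth (backs⁺ b) in
    j , ≤-trans j≤ (≤-trans (≤-reflexive (↭-length (sort-↭ (back u)))) (back-length u)) , eq

  open Rounds p (λ _ → refl)

  -- The `a`-colours of `p 0 u` up to `p c u` in a single code: `u` itself and room for `c`
  -- back-neighbours. Entry 0 makes this a refinement of `a`.
  start : V → Fin (c ^ suc c)
  start u = funToFin {suc c} (λ j → a (p (toℕ j) u))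

  start-p : ∀ {u u′ j} → j ≤ c → start u ≡ start u′ → a (p j u) ≡ a (p j u′)
  start-p {u} {u′} {j} j≤c e = subst (λ i → a (p i u) ≡ a (p i u′)) (F.toℕ-fromℕ< (s≤s j≤c))
    (trans (sym (F.finToFun-funToFin (λ i → a (p (toℕ i) u)) k))
      (trans (cong (λ s → finToFun s k) e) (F.finToFun-funToFin (λ i → a (p (toℕ i) u′)) k)))
    where k = fromℕ< (s≤s j≤c)

  -- From the common vertex `p j u` both successors are reached within 2, so one reaches the other
  -- within 4. This is where radius 4 for `a` comes from.
  nested : ∀ {j} → j < c → Nested j start
  nested {j} j<c {u} {u′} e q = a-inj-share ≤-refl (p-step j u)
    (subst (λ v → R 2 v (p (suc j) u′)) (sym q) (p-step j u′)) (start-p j<c e)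

  abstract
    φΣ : Σ (V → Fin (palette (c ^ suc c) c)) λ φ →
           (∀ {u u′} → φ u ≡ φ u′ → start u ≡ start u′) × (∀ {j} → j ≤ c → ∀ u₀ → Parity (Class j φ u₀) true)
    φΣ = rounds c start nested

  φ : V → Fin (palette (c ^ suc c) c)
  φ = proj₁ φΣ

  φ-p : ∀ {u u′ j} → j ≤ c → φ u ≡ φ u′ → a (p j u) ≡ a (p j u′)
  φ-p j≤c e = start-p j≤c (proj₁ (proj₂ φΣ) e)

  φ-a : ∀ {u u′} → φ u ≡ φ u′ → a u ≡ a u′
  φ-a = φ-p z≤n

  adj⇒a≢ : ∀ {u v} → adj G u v ≡ true → a u ≢ a v
  adj⇒a≢ {u} {v} e eq = case trans (sym e) (trans (cong (adj G u) (sym u≡v)) (irrefl G u)) of λ ()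
    where
    u≡v : u ≡ v
    u≡v with R-edge e
    ... | inj₁ q = a-inj (R-mono (s≤s z≤n) q) eq
    ... | inj₂ q = sym (a-inj (R-mono (s≤s z≤n) q) (sym eq))

  Nbr : V → V → V → Set
  Nbr v u₀ u = adj G v u ≡ true × φ u ≡ φ u₀

  -- If `u` precedes `v`, then `u` and `u₀` share `v`; if it follows, it reaches `u₀` through `v`.
  -- Either way the distance is at most 2, so `a` separates them unless they are equal.
  back-unique : ∀ {v u₀ u} → Back v u₀ → Nbr v u₀ u → u ≡ u₀
  back-unique b (e , eq) with adj⇒Back e
  ... | inj₁ b′ = a-inj-share (s≤s (s≤s z≤n)) (Back⇒R b′) (Back⇒R b) (φ-a eq)
  ... | inj₂ b′ = a-inj (R-mono (s≤s (s≤s z≤n)) (R-trans (Back⇒R b′) (Back⇒R b))) (φ-a eq)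

  -- If `u₀` precedes `v`, it is the only neighbour of its colour. Otherwise `v` is some `p j u₀`,
  -- and the neighbours of that colour are exactly the level-`j` class of `u₀`, which the rounds
  -- made odd.
  nbr-odd : ∀ {v u₀} → adj G v u₀ ≡ true → Parity (Nbr v u₀) true
  nbr-odd {v} {u₀} e with adj⇒Back e
  ... | inj₁ b = Parity-one u₀ (back-unique b) (e , refl) (λ u → (adj G v u B.≟ true) ×-dec (φ u F.≟ φ u₀))
  ... | inj₂ b with p-hits b
  ...   | j , j≤c , refl = Parity-⇔ to from (proj₂ (proj₂ φΣ) j≤c u₀)
    where
    to : ∀ {u} → Class j φ u₀ u → Nbr (p j u₀) u₀ u
    to {u} (q , eq) with p-∈ j u
    ... | inj₂ (e′ , _) = trans (adj-sym G _ u) (subst (λ x → adj G u x ≡ true) q e′) , eq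
    -- Here `p j u` is `u` itself, so `u` would equal `v` and share its `a`-colour with the adjacent
    -- `u₀`.
    ... | inj₁ q′       = ⊥-elim (adj⇒a≢ e (trans (cong a (trans (sym q) q′)) (φ-a eq)))
    from : ∀ {u} → Nbr (p j u₀) u₀ u → Class j φ u₀ u
    from {u} (e′ , eq) with adj⇒Back e′
    -- For `u` before `v`, `back-unique` with the roles of `u` and `u₀` exchanged gives `u₀ ≡ u`.
    ... | inj₁ b′ = cong (p j) (sym (back-unique b′ (e , sym eq))) , eq
    -- For `u` after `v`, both `p j u` and `v` are reached from `u` within 1 and have the same
    -- `a`-colour, hence coincide.
    ... | inj₂ b′ = a-inj-share (s≤s (s≤s z≤n)) (p-reach j u) (Back⇒R b′) (φ-p j≤c eq) , eq

  colouring : χso≤ G (palette (c ^ suc c) c)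
  colouring = φ , (λ u v e eq → adj⇒a≢ e (φ-a eq)) , zeroOrOdd
    where
    test : ∀ v i u → Bool
    test v i u = adj G v u ∧ eqᵇ (φ u) i
    zeroOrOdd : ∀ v i → nbrCount G φ v i ≡ 0 ⊎ nbrCount G φ v i % 2 ≡ 1
    zeroOrOdd v i with F.any? (λ u → test v i u B.≟ true)
    ... | no none = inj₁ (count-none (test v i) (allFin (n G)) (λ u → ¬-not (λ e → none (u , e))))
    ... | yes (u₀ , e₀) with eqᵇ⇒≡ {u = φ u₀} (∧-conicalʳ _ _ e₀)
    ...   | refl with nbr-odd (∧-conicalˡ _ _ e₀)
    ...     | odd-nbrs = inj₂ (count-odd odd-nbrs (decides sound total))
      where
      sound : ∀ {u} → test v i u ≡ true → Nbr v u₀ u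
      sound {u} e = ∧-conicalˡ _ _ e , eqᵇ⇒≡ (∧-conicalʳ (adj G v u) _ e)
      total : ∀ {u} → Nbr v u₀ u → test v i u ≡ true
      total (e , eq) = cong₂ _∧_ e (≡⇒eqᵇ eq)

-- The bound for subgraphs of sums.

theorem14 : Σ (ℕ → ℕ → ℕ → ℕ) λ f →
    ∀ (w k t : ℕ) (S G : Graph) → IsSum w k t S → Subgraph G S → χso≤ G (f w k t)
-- Greedy colouring at radius 4 takes one colour more than the reach bound; the `c ^ suc c` initial
-- colours are then tripled in each of `c` rounds.
theorem14 = (λ w k t → let c = suc (sumBound w k t 4) in palette (c ^ suc c) c) ,
  λ w k t S G S-sum (ι , ι-inj , ι-adj) →
    let h       = sum-reach S-sum
        a , inj = reach-colouring h 4
    -- The order and the colouring `a` are both restricted from `S` to `G`; separation survives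
    -- because the pullback keeps `R`.
    in StrongOdd.colouring G (pullback ι ι-inj (λ {u} {v} → ι-adj u v) (proj₁ h)) (a ∘ ι) (λ q eq → ι-inj (inj q eq))
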